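{- If $m\geq 3$ is an integer, then $\alpha(C(P_{m}))=\left\lfloor \frac{(m+1)^{2}}{4}\right\rfloor$.
   Context: Graphs are finite and simple. For a graph $G$, the pair graph $C(G)$ (also called complete double vertex graph) is the graph whose vertices are all $2$-multisets of $V(G)$ (so $\{x,x\}$ is allowed), where two vertices $\{x,y\}$ and $\{u,v\}$ are adjacent if and only if $\{x,y\}\cap\{u,v\}=\{a\}$ (multiset intersection) for some $a$ and, writing $x=u=a$, the vertices $y$ and $v$ are adjacent in $G$; that is, the two multisets can be written as $\{a,y\}$ and $\{a,v\}$ with $yv$ an edge of $G$. $P_m$ is the path graph with $m$ vertices, and $\alpha(G)$ denotes the independence number of $G$. -}

module Defs where

open import Data.Fin using (Fin; toℕ)
import Data.Fin.Properties as Fin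
open import Data.List using (List; length; allFin; cartesianProduct)
open import Data.List.Membership.Propositional.Properties using (∈-allFin)
import Data.List.Membership.Setoid as Membership
open import Data.List.Membership.Setoid.Properties using (∈-cartesianProduct⁺)
import Data.List.Relation.Unary.Any as Any
open import Data.List.Relation.Unary.AllPairs using (AllPairs)
import Data.List.Relation.Unary.Unique.Setoid as UniqueSetoid
open import Data.Nat using (ℕ; suc; _≤_)
open import Data.Nat.Properties using (1+n≢n)
open import Data.Product using (_×_; _,_; Σ-syntax; ∃-syntax)
open import Data.Sum using (_⊎_; inj₁; inj₂; swap)
open import Level using (0ℓ)
open import Relation.Binary
  using (DecSetoid; Rel; Symmetric; Irreflexive; _Respects₂_)
open import Relation.Binary.PropositionalEquality
  using (_≡_; refl; resp₂)
open import Relation.Nullary using (¬_)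
open import Relation.Nullary.Decidable using (_×-dec_; _⊎-dec_)

-- Vertices are taken up to the equality _≈_ of a decidable setoid, so that
-- multisets can serve as vertices. The list `vertices` witnesses finiteness;
-- it may contain repetitions.
record Graph : Set₁ where
  field
    vertexSetoid : DecSetoid 0ℓ 0ℓ

  open DecSetoid vertexSetoid public
    using (_≈_; _≟_; setoid) renaming (Carrier to Vertex)
  open Membership setoid public using (_∈_)

  field
    vertices : List Vertex
    complete : ∀ x → x ∈ vertices
    _~_      : Rel Vertex 0ℓ
    ~-resp-≈ : _~_ Respects₂ _≈_
    ~-sym    : Symmetric _~_
    ~-irrefl : Irreflexive _≈_ _~_

-- A finite set of vertices is a repetition-free list, its cardinality being
-- the length of the list.
record IsIndependentSet (G : Graph) (S : List (Graph.Vertex G)) : Set where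
  open Graph G
  open UniqueSetoid setoid using (Unique)
  field
    distinct    : Unique S
    nonadjacent : AllPairs (λ x y → ¬ (x ~ y)) S

-- α(G) = k: k is the largest cardinality of an independent set of G.
record IsIndependenceNumber (G : Graph) (k : ℕ) : Set where
  open Graph G using (Vertex)
  field
    attained : Σ[ S ∈ List Vertex ] (IsIndependentSet G S × length S ≡ k)
    maximal  : ∀ (S : List Vertex) → IsIndependentSet G S → length S ≤ k

-- The pair (x , y) represents the 2-multiset {x, y}; x and y may coincide.
module TwoMultiset (V : DecSetoid 0ℓ 0ℓ) where
  open DecSetoid V
    using (_≈_; _≟_)
    renaming (Carrier to A; refl to ≈-refl; sym to ≈-sym; trans to ≈-trans)

  infix 4 _≋_

  _≋_ : Rel (A × A) 0ℓ
  (x , y) ≋ (u , v) = (x ≈ u × y ≈ v) ⊎ (x ≈ v × y ≈ u)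

  ≋-sym : Symmetric _≋_
  ≋-sym (inj₁ (p , q)) = inj₁ (≈-sym p , ≈-sym q)
  ≋-sym (inj₂ (p , q)) = inj₂ (≈-sym q , ≈-sym p)

  ≋-trans : ∀ {s t r} → s ≋ t → t ≋ r → s ≋ r
  ≋-trans (inj₁ (p , q)) (inj₁ (p′ , q′)) = inj₁ (≈-trans p p′ , ≈-trans q q′)
  ≋-trans (inj₁ (p , q)) (inj₂ (p′ , q′)) = inj₂ (≈-trans p p′ , ≈-trans q q′)
  ≋-trans (inj₂ (p , q)) (inj₁ (p′ , q′)) = inj₂ (≈-trans p q′ , ≈-trans q p′)
  ≋-trans (inj₂ (p , q)) (inj₂ (p′ , q′)) = inj₁ (≈-trans p q′ , ≈-trans q p′)

  decSetoid : DecSetoid 0ℓ 0ℓ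
  decSetoid = record
    { Carrier = A × A
    ; _≈_     = _≋_
    ; isDecEquivalence = record
      { isEquivalence = record
        { refl  = inj₁ (≈-refl , ≈-refl)
        ; sym   = ≋-sym
        ; trans = ≋-trans
        }
      ; _≟_ = λ { (x , y) (u , v) →
                  ((x ≟ u) ×-dec (y ≟ v)) ⊎-dec ((x ≟ v) ×-dec (y ≟ u)) }
      }
    }

  -- Multisets with a common element have equal remaining elements.
  ≋-cancel : ∀ {a y v} → (a , y) ≋ (a , v) → y ≈ v
  ≋-cancel (inj₁ (_ , y≈v))   = y≈v
  ≋-cancel (inj₂ (a≈v , y≈a)) = ≈-trans y≈a a≈v

module _ (G : Graph) where
  open Graph G
  open TwoMultiset vertexSetoid

  -- Since y ~ v forces y ≉ v, the multiset intersection of {a, y} and {a, v}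
  -- is then exactly {a}.
  PairAdjacent : Rel (Vertex × Vertex) 0ℓ
  PairAdjacent s t =
    ∃[ a ] ∃[ y ] ∃[ v ] (s ≋ (a , y) × t ≋ (a , v) × y ~ v)

  C : Graph
  C = record
    { vertexSetoid = decSetoid
    ; vertices = cartesianProduct vertices vertices
    ; complete = λ { (x , y) →
        Any.map inj₁
          (∈-cartesianProduct⁺ setoid setoid (complete x) (complete y)) }
    ; _~_ = PairAdjacent
    ; ~-resp-≈ =
        (λ { t≋t′ (a , y , v , p , q , e) →
             a , y , v , p , ≋-trans (≋-sym t≋t′) q , e }) ,
        (λ { s≋s′ (a , y , v , p , q , e) →
             a , y , v , ≋-trans (≋-sym s≋s′) p , q , e })
    ; ~-sym = λ { (a , y , v , p , q , e) → a , v , y , q , p , ~-sym e }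
    ; ~-irrefl = λ { s≋t (a , y , v , p , q , e) →
        ~-irrefl (≋-cancel (≋-trans (≋-sym p) (≋-trans s≋t q))) e }
    }

Consecutive : ∀ {m} → Rel (Fin m) 0ℓ
Consecutive i j = suc (toℕ i) ≡ toℕ j ⊎ suc (toℕ j) ≡ toℕ i

P : ℕ → Graph
P m = record
  { vertexSetoid = Fin.≡-decSetoid m
  ; vertices = allFin m
  ; complete = ∈-allFin
  ; _~_      = Consecutive
  ; ~-resp-≈ = resp₂ Consecutive
  ; ~-sym    = swap
  ; ~-irrefl = λ { refl (inj₁ e) → 1+n≢n e ; refl (inj₂ e) → 1+n≢n e }
  }

{-# OPTIONS --safe #-}

-- C(P m) is the triangular piece {(x , y) : x ≤ y} of the square grid.  The
-- pairs with y − x even form an independent set, as adjacent pairs have sums of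
-- different parity.  The edges from (x , y) to (x , suc y), for y − x even,
-- together with the single vertices (x , m − 1), cover C(P m) by as many cliques
-- as there are even pairs; each clique meets an independent set at most once.
module Submission where

open import Defs
open import Data.Fin using (Fin; zero; suc; toℕ; fromℕ<; inject₁)
import Data.Fin as Fin
open import Data.Fin.Properties
  using (toℕ-injective; toℕ<n; toℕ-fromℕ<; toℕ-inject₁; inject₁-injective; pigeonhole)
open import Data.List using (List; []; _∷_; _++_; map; length; lookup; allFin)
open import Data.List.Membership.Propositional using (_∈_)
open import Data.List.Membership.Propositional.Properties
  using (∈-allFin; ∈-map⁺; ∈-map⁻; ∈-lookup; ∈-++⁺ˡ; ∈-++⁺ʳ)
open import Data.List.Properties using (length-++; length-map; length-tabulate)
open import Data.List.Relation.Unary.All as All using (All; []; _∷_)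
import Data.List.Relation.Unary.All.Properties as All
open import Data.List.Relation.Unary.AllPairs using (AllPairs; []; _∷_)
open import Data.List.Relation.Unary.Any as Any using (Any)
open import Data.List.Relation.Unary.Any.Properties using (lookup-index)
open import Data.List.Relation.Unary.Unique.Propositional using (Unique)
import Data.List.Relation.Unary.Unique.Propositional.Properties as Unique
open import Data.Nat using (ℕ; zero; suc; _+_; _*_; _^_; _≤_; _<_; s≤s; s<s⁻¹)
open import Data.Nat.DivMod using (_/_; _%_; m≡m%n+[m/n]*n; m%n<n; m*n/n≡m; +-distrib-/-∣ʳ)
open import Data.Nat.Divisibility using (_∣_; divides; divides-refl; ∣m+n∣m⇒∣n; ∣1⇒≡1)
open import Data.Nat.Properties
open import Data.Nat.Tactic.RingSolver using (solve-∀)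
open import Data.Product using (_×_; _,_; proj₁; proj₂; ∃-syntax)
open import Data.Sum using (_⊎_; inj₁; inj₂; [_,_]′)
open import Function using (_∘_; id)
open import Level using (Level)
open import Relation.Binary using (Rel)
open import Relation.Binary.PropositionalEquality
open import Relation.Nullary using (¬_)
open import Relation.Unary using (Pred)

private
  variable
    a p r q : Level
    A : Set a
    m : ℕ

AllPairs-lookup : {R : Rel A r} {xs : List A} → AllPairs R xs →
                  ∀ {i j} → i Fin.< j → R (lookup xs i) (lookup xs j)
AllPairs-lookup (Rx ∷ _)  {zero}  {suc j} _   = All.lookup Rx (∈-lookup j)
AllPairs-lookup (_ ∷ Rxs) {suc i} {suc j} i<j = AllPairs-lookup Rxs (s<s⁻¹ i<j)

-- Serves to pass from `≢` on a list of even pairs to `≋`-distinctness and nonadjacency, both of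
-- which rely on the even gaps of the two entries.
AllPairs-map-with : {P : Pred A p} {R : Rel A r} {Q : Rel A q} →
                    (∀ {x y} → P x → P y → R x y → Q x y) →
                    ∀ {xs} → All P xs → AllPairs R xs → AllPairs Q xs
AllPairs-map-with f []         []         = []
AllPairs-map-with f (px ∷ pxs) (Rx ∷ Rxs) =
  All.zipWith (λ (py , Rxy) → f px py Rxy) (pxs , Rx) ∷ AllPairs-map-with f pxs Rxs

module _ (G : Graph) where
  open Graph G hiding (_∈_)

  -- Send each position of `S` to the index of a clique covering its vertex. If `S` were longer than
  -- `K`, two positions would share a clique, so their vertices would be equal or adjacent, against
  -- independence.
  cliqueCover⇒bound : {I : Set a} {Covers : I → Vertex → Set p} (K : List I) →
    (∀ s → Any (λ t → Covers t s) K) →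
    (∀ {t s s′} → Covers t s → Covers t s′ → s ≈ s′ ⊎ s ~ s′) →
    ∀ S → IsIndependentSet G S → length S ≤ length K
  cliqueCover⇒bound {Covers = Covers} K covered clique S indep = ≮⇒≥ λ K<S →
    let i , j , i<j , eq = pigeonhole K<S λ k → Any.index (covered (lookup S k))
        coveredᵢ = lookup-index (covered (lookup S i))
        coveredⱼ = lookup-index (covered (lookup S j))
    in [ AllPairs-lookup distinct i<j , AllPairs-lookup nonadjacent i<j ]′
         (clique (subst (λ k → Covers (lookup K k) (lookup S i)) eq coveredᵢ) coveredⱼ)
    where open IsIndependentSet indep

open module PathPairs {m} = TwoMultiset (Graph.vertexSetoid (P m))
  using (_≋_; ≋-sym; ≋-trans)

-- The equation forces `x ≤ y`, so it also selects one of the two orderings of a multiset.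
EvenGap : Fin m × Fin m → Set
EvenGap (x , y) = ∃[ e ] e * 2 + toℕ x ≡ toℕ y

diagonal : Fin m → Fin m × Fin m
diagonal x = x , x

widen : Fin m × Fin m → Fin (2 + m) × Fin (2 + m)
widen (x , y) = inject₁ (inject₁ x) , suc (suc y)

-- An even gap is zero, giving the diagonal, or at least two; in the latter case lowering `y` by two
-- leaves an even pair over `Fin m`.
evenPairs : ∀ m → List (Fin m × Fin m)
evenPairs 0             = []
evenPairs 1             = (zero , zero) ∷ []
evenPairs (suc (suc m)) = map diagonal (allFin (2 + m)) ++ map widen (evenPairs m)

toℕ-inject₁² : (x : Fin m) → toℕ (inject₁ (inject₁ x)) ≡ toℕ x
toℕ-inject₁² x = trans (toℕ-inject₁ (inject₁ x)) (toℕ-inject₁ x)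

EvenGap⇒≤ : {x y : Fin m} → EvenGap (x , y) → toℕ x ≤ toℕ y
EvenGap⇒≤ (e , eq) = m+n≤o⇒n≤o (e * 2) (≤-reflexive eq)

widen-EvenGap : {s : Fin m × Fin m} → EvenGap s → EvenGap (widen s)
widen-EvenGap {s = x , y} (e , eq) =
  suc e , cong (2 +_) (trans (cong (e * 2 +_) (toℕ-inject₁² x)) eq)

evenPairs-EvenGap : ∀ m → All EvenGap (evenPairs m)
evenPairs-EvenGap 0             = []
evenPairs-EvenGap 1             = (0 , refl) ∷ []
evenPairs-EvenGap (suc (suc m)) =
  All.++⁺ (All.map⁺ (All.tabulate⁺ {f = id} λ _ → 0 , refl))
          (All.map⁺ (All.map widen-EvenGap (evenPairs-EvenGap m)))

EvenGap⇒∈evenPairs : ∀ m {x y : Fin m} → EvenGap (x , y) → (x , y) ∈ evenPairs m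
EvenGap⇒∈evenPairs 1 {zero} {zero} _ = Any.here refl
EvenGap⇒∈evenPairs (suc (suc m)) (0 , eq) rewrite toℕ-injective eq =
  ∈-++⁺ˡ (∈-map⁺ diagonal (∈-allFin _))
EvenGap⇒∈evenPairs (suc (suc m)) {x} {suc (suc y)} (suc e , eq) =
  ∈-++⁺ʳ (map diagonal (allFin (2 + m)))
    (subst (λ z → (z , suc (suc y)) ∈ map widen (evenPairs m)) x′≡x
      (∈-map⁺ widen (EvenGap⇒∈evenPairs m (e , gap))))
  where
  eq′ : e * 2 + toℕ x ≡ toℕ y
  eq′ = suc-injective (suc-injective eq)

  -- Since `x` is at most the lowered `y`, it already lies in `Fin m`, and `widen` can restore it.
  x<m : toℕ x < m
  x<m = ≤-<-trans (m+n≤o⇒n≤o (e * 2) (≤-reflexive eq′)) (toℕ<n y)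

  x′≡x : inject₁ (inject₁ (fromℕ< x<m)) ≡ x
  x′≡x = toℕ-injective (trans (toℕ-inject₁² _) (toℕ-fromℕ< x<m))

  gap : e * 2 + toℕ (fromℕ< x<m) ≡ toℕ y
  gap = trans (cong (e * 2 +_) (toℕ-fromℕ< x<m)) eq′

widen-injective : {s t : Fin m × Fin m} → widen s ≡ widen t → s ≡ t
widen-injective eq = cong₂ _,_
  (inject₁-injective (inject₁-injective (cong proj₁ eq)))
  (toℕ-injective (suc-injective (suc-injective (cong (toℕ ∘ proj₂) eq))))

-- From `x ≤ y` follows `x < 2 + y`, so a widened even pair lies strictly off the diagonal.
diagonal≢widen : {z : Fin (2 + m)} {s : Fin m × Fin m} →
                 EvenGap s → diagonal z ≢ widen s
diagonal≢widen {s = x , y} gap eq = <⇒≢ (s≤s (m≤n⇒m≤1+n (EvenGap⇒≤ gap)))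
  (trans (sym (toℕ-inject₁² x))
    (cong toℕ (trans (sym (cong proj₁ eq)) (cong proj₂ eq))))

evenPairs-unique : ∀ m → Unique (evenPairs m)
evenPairs-unique 0             = []
evenPairs-unique 1             = [] ∷ []
evenPairs-unique (suc (suc m)) = Unique.++⁺
  (Unique.map⁺ (cong proj₁) (Unique.allFin⁺ (2 + m)))
  (Unique.map⁺ widen-injective (evenPairs-unique m))
  λ (∈diagonals , ∈widened) →
    let _ , _  , eq  = ∈-map⁻ diagonal ∈diagonals
        _ , s∈ , eq′ = ∈-map⁻ widen ∈widened
    in diagonal≢widen (All.lookup (evenPairs-EvenGap m) s∈) (trans (sym eq) eq′)

-- If the coordinates are swapped, then `x ≤ y` and `y ≤ x`, so the pair is diagonal.
EvenGap-≋⇒≡ : {s t : Fin m × Fin m} → EvenGap s → EvenGap t → s ≋ t → s ≡ t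
EvenGap-≋⇒≡ _ _ (inj₁ (refl , refl)) = refl
EvenGap-≋⇒≡ gap gap′ (inj₂ (refl , refl))
  with refl ← toℕ-injective (≤-antisym (EvenGap⇒≤ gap) (EvenGap⇒≤ gap′)) = refl

-- The sum has the parity of the gap but is symmetric, hence well defined on multisets.
weight : Fin m × Fin m → ℕ
weight (x , y) = toℕ x + toℕ y

weight-resp-≋ : {s t : Fin m × Fin m} → s ≋ t → weight s ≡ weight t
weight-resp-≋ (inj₁ (refl , refl))             = refl
weight-resp-≋ {s = x , y} (inj₂ (refl , refl)) = +-comm (toℕ x) (toℕ y)

EvenGap⇒2∣weight : {s : Fin m × Fin m} → EvenGap s → 2 ∣ weight s
EvenGap⇒2∣weight {s = x , y} (e , eq) =
  divides (e + toℕ x) (trans (cong (toℕ x +_) (sym eq)) (double e (toℕ x)))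
  where
  double : ∀ e x → x + (e * 2 + x) ≡ (e + x) * 2
  double = solve-∀

2∣n⇒2∤1+n : ∀ {n} → 2 ∣ n → ¬ 2 ∣ suc n
2∣n⇒2∤1+n {n} 2∣n 2∣1+n
  with () ← ∣1⇒≡1 (∣m+n∣m⇒∣n (subst (2 ∣_) (+-comm 1 n) 2∣1+n) 2∣n)

-- The common element `a` contributes equally to both weights, and the remaining elements are
-- consecutive.
adjacent⇒weight-consecutive : {s t : Fin m × Fin m} → PairAdjacent (P m) s t →
  suc (weight s) ≡ weight t ⊎ suc (weight t) ≡ weight s
adjacent⇒weight-consecutive (a , y , v , s≋ , t≋ , y~v)
  rewrite weight-resp-≋ s≋ | weight-resp-≋ t≋ with y~v
... | inj₁ eq = inj₁ (trans (sym (+-suc (toℕ a) (toℕ y))) (cong (toℕ a +_) eq))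
... | inj₂ eq = inj₂ (trans (sym (+-suc (toℕ a) (toℕ v))) (cong (toℕ a +_) eq))

EvenGap⇒nonadjacent : {s t : Fin m × Fin m} →
                      EvenGap s → EvenGap t → ¬ PairAdjacent (P m) s t
EvenGap⇒nonadjacent gap gap′ s~t with adjacent⇒weight-consecutive s~t
... | inj₁ eq = 2∣n⇒2∤1+n (EvenGap⇒2∣weight gap)
                  (subst (2 ∣_) (sym eq) (EvenGap⇒2∣weight gap′))
... | inj₂ eq = 2∣n⇒2∤1+n (EvenGap⇒2∣weight gap′)
                  (subst (2 ∣_) (sym eq) (EvenGap⇒2∣weight gap))

evenPairs-independent : ∀ m → IsIndependentSet (C (P m)) (evenPairs m)
evenPairs-independent m = record
  { distinct    = AllPairs-map-with (λ gap gap′ s≢t → s≢t ∘ EvenGap-≋⇒≡ gap gap′)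
                    (evenPairs-EvenGap m) (evenPairs-unique m)
  ; nonadjacent = AllPairs-map-with (λ gap gap′ _ → EvenGap⇒nonadjacent gap gap′)
                    (evenPairs-EvenGap m) (evenPairs-unique m)
  }

-- The successor of `y` is quantified because it does not exist when `y` is the last vertex; the
-- clique is then a single vertex.
Covers : Fin m × Fin m → Fin m × Fin m → Set
Covers (x , y) s = s ≋ (x , y) ⊎ (∃[ y′ ] suc (toℕ y) ≡ toℕ y′ × s ≋ (x , y′))

Covers-clique : {t s s′ : Fin m × Fin m} → Covers t s → Covers t s′ →
                s ≋ s′ ⊎ PairAdjacent (P m) s s′
Covers-clique (inj₁ s≋) (inj₁ s′≋) = inj₁ (≋-trans s≋ (≋-sym s′≋))
-- The common element is the first coordinate `x` of the index, and the edge joins `y` to its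
-- successor.
Covers-clique (inj₁ s≋) (inj₂ (_ , eq , s′≋)) = inj₂ (_ , _ , _ , s≋ , s′≋ , inj₁ eq)
Covers-clique (inj₂ (_ , eq , s≋)) (inj₁ s′≋) = inj₂ (_ , _ , _ , s≋ , s′≋ , inj₂ eq)
Covers-clique (inj₂ (_ , eq , s≋)) (inj₂ (_ , eq′ , s′≋))
  with refl ← toℕ-injective (trans (sym eq) eq′) = inj₁ (≋-trans s≋ (≋-sym s′≋))

even⊎odd : ∀ n → (∃[ e ] n ≡ e * 2) ⊎ (∃[ e ] n ≡ suc (e * 2))
even⊎odd n with n % 2 | m%n<n n 2 | m≡m%n+[m/n]*n n 2
... | 0 | _ | eq = inj₁ (n / 2 , eq)
... | 1 | _ | eq = inj₂ (n / 2 , eq)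
... | suc (suc _) | s≤s (s≤s ()) | _

-- A pair with even gap indexes its own clique; one with odd gap is the upper end of the clique
-- indexed by the pair with `y` lowered by one.
ordered-covered : {x y : Fin m} → toℕ x ≤ toℕ y →
                  ∃[ t ] EvenGap t × Covers t (x , y)
ordered-covered {x = x} {y} x≤y with d , eq ← m≤n⇒∃[o]m+o≡n x≤y with even⊎odd d
... | inj₁ (e , refl) =
  (x , y) , (e , trans (+-comm (e * 2) (toℕ x)) eq) , inj₁ (inj₁ (refl , refl))
... | inj₂ (e , refl)
  -- An odd gap makes `y` positive, so the predecessor `y₀` exists.
  with y | trans (+-comm (suc (e * 2)) (toℕ x)) eq
... | suc y₀ | eq′ =
  (x , inject₁ y₀) ,
  (e , trans (suc-injective eq′) (sym (toℕ-inject₁ y₀))) ,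
  inj₂ (suc y₀ , cong suc (toℕ-inject₁ y₀) , inj₁ (refl , refl))

Covers-resp-≋ : {t s s′ : Fin m × Fin m} → s′ ≋ s → Covers t s → Covers t s′
Covers-resp-≋ s′≋s (inj₁ s≋)             = inj₁ (≋-trans s′≋s s≋)
Covers-resp-≋ s′≋s (inj₂ (y′ , eq , s≋)) = inj₂ (y′ , eq , ≋-trans s′≋s s≋)

covered : (s : Fin m × Fin m) → ∃[ t ] EvenGap t × Covers t s
covered (x , y) with ≤-total (toℕ x) (toℕ y)
... | inj₁ x≤y = ordered-covered x≤y
... | inj₂ y≤x with t , gap , covers ← ordered-covered y≤x =
  t , gap , Covers-resp-≋ {t = t} (inj₂ (refl , refl)) covers

evenPairs-cover : ∀ m s → Any (λ t → Covers t s) (evenPairs m)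
evenPairs-cover m s with t , gap , covers ← covered s =
  Any.map (λ { refl → covers }) (EvenGap⇒∈evenPairs m gap)

-- Since `(m + 3) ^ 2` exceeds `(m + 1) ^ 2` by `4 * (m + 2)`, the floor grows by exactly the
-- `m + 2` new diagonal pairs.
length-evenPairs : ∀ m → length (evenPairs m) ≡ (m + 1) ^ 2 / 4
length-evenPairs 0 = refl
length-evenPairs 1 = refl
length-evenPairs (suc (suc m)) = begin
  length (map diagonal (allFin (2 + m)) ++ map widen (evenPairs m))
    ≡⟨ length-++ (map diagonal (allFin (2 + m))) ⟩
  length (map diagonal (allFin (2 + m))) + length (map widen (evenPairs m))
    ≡⟨ cong₂ _+_ (trans (length-map diagonal (allFin (2 + m))) (length-tabulate {n = 2 + m} id))
                 (length-map widen (evenPairs m)) ⟩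
  2 + m + length (evenPairs m)
    ≡⟨ cong (2 + m +_) (length-evenPairs m) ⟩
  2 + m + (m + 1) ^ 2 / 4
    ≡⟨ +-comm (2 + m) _ ⟩
  (m + 1) ^ 2 / 4 + (2 + m)
    ≡⟨ cong ((m + 1) ^ 2 / 4 +_) (m*n/n≡m (2 + m) 4) ⟨
  (m + 1) ^ 2 / 4 + (2 + m) * 4 / 4
    ≡⟨ +-distrib-/-∣ʳ ((m + 1) ^ 2) (divides-refl (2 + m)) ⟨
  ((m + 1) ^ 2 + (2 + m) * 4) / 4
    ≡⟨ cong (_/ 4) (square m) ⟩
  (2 + m + 1) ^ 2 / 4 ∎
  where
  open ≡-Reasoning
  square : ∀ m → (m + 1) * ((m + 1) * 1) + (2 + m) * 4
             ≡ (2 + m + 1) * ((2 + m + 1) * 1)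
  square = solve-∀

theorem1p3 : ∀ (m : ℕ) → 3 ≤ m → IsIndependenceNumber (C (P m)) (((m + 1) ^ 2) / 4)
theorem1p3 m _ = record
  -- One list is both the independent set and the index list of the cover, so a single length count
  -- serves both bounds.
  { attained = evenPairs m , evenPairs-independent m , length-evenPairs m
  ; maximal  = λ S indep → subst (length S ≤_) (length-evenPairs m)
      (cliqueCover⇒bound (C (P m)) (evenPairs m) (evenPairs-cover m)
        (λ {t} → Covers-clique {t = t}) S indep)
  }
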